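{- If a graph $G$ is not separation $2$-choosable, then it contains two subgraphs $H_1$ and $H_2$ such that for $i=1,2$: (i) $H_i$ is an (ordered) lollipop or an (ordered) cycle; (ii) the cycle contained in $H_i$ has length at least $4$; (iii) the first vertices of $H_1$ and $H_2$, respectively, are identical; (iv) the second vertices of $H_1$ and $H_2$ are distinct; (v) if $H_1$ or $H_2$ is a cycle, then the second to last vertices of $H_1$ and $H_2$, respectively, are distinct; (vi) if both $H_1$ and $H_2$ are cycles, then the second and second to last vertices of $H_1$ and $H_2$, respectively, are four distinct vertices.
   Context: Graphs are finite and simple. A graph $G$ is separation $k$-choosable if for every assignment of lists $L(v)$ of $k$ colors to the vertices such that $|L(x)\cap L(y)|\le 1$ for every edge $xy$, there is a proper coloring $\varphi$ of $G$ with $\varphi(v)\in L(v)$ for all $v\in V(G)$. Let $P=v_1e_1v_2\dots e_{d-1}v_d$ be a path (with distinct vertices $v_1,\dots,v_d$ and $e_i=v_iv_{i+1}$). The sequence $C=v_1e_1v_2\dots v_de_dv_1$ is an (ordered) cycle if $e_d=v_dv_1$ is an edge. The sequence $D=v_1e_1v_2\dots v_de_dv_j$ is an (ordered) lollipop if $e_d=v_dv_j$ is an edge and $j\in\{2,\dots,d-2\}$; the cycle contained in it is the one on $v_j,\dots,v_d$. In both cases the first vertex is $v_1$, the second vertex is $v_2$, and the second to last vertex (of the sequence) is $v_d$. -}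

module Defs where

open import Data.Empty using (⊥)
open import Data.Fin using (Fin; zero; suc; toℕ; fromℕ; inject₁)
open import Data.Fin.Subset using (Subset; _∈_; _∩_; ∣_∣)
open import Data.Nat using (ℕ; suc; _+_; _∸_; _≤_)
open import Data.Product using (Σ-syntax; _×_)
open import Data.Unit using (⊤)
open import Function.Definitions using (Injective)
open import Relation.Binary using (Rel; Decidable; Symmetric; Irreflexive)
open import Relation.Binary.PropositionalEquality using (_≡_; _≢_)
open import Level using (0ℓ)

record Graph : Set₁ where
  infix 4 _~_ _~?_
  field
    order    : ℕ
    _~_      : Rel (Fin order) 0ℓ
    _~?_     : Decidable _~_
    ~-sym    : Symmetric _~_
    ~-irrefl : Irreflexive _≡_ _~_

  Vertex : Set
  Vertex = Fin order

-- Finitely many vertices carry finitely many colors in total, so an arbitrary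
-- assignment of k-element lists is one over a palette Fin c, for some c.
SeparationChoosable : Graph → ℕ → Set
SeparationChoosable G k =
  ∀ (c : ℕ) (L : Vertex → Subset c) →
  (∀ v → ∣ L v ∣ ≡ k) →
  (∀ x y → x ~ y → ∣ L x ∩ L y ∣ ≤ 1) →
  Σ[ φ ∈ (Vertex → Fin c) ]
    (∀ x y → x ~ y → φ x ≢ φ y) × (∀ v → φ v ∈ L v)
  where open Graph G

-- A path with n edges v₁ e₁ v₂ … eₙ vₙ₊₁; indices are shifted by one, so that
-- vertex i is v with subscript suc (toℕ i).
record Path (G : Graph) (n : ℕ) : Set where
  open Graph G
  field
    vertex   : Fin (suc n) → Vertex
    distinct : Injective _≡_ _≡_ vertex
    edge     : ∀ (i : Fin n) → vertex (inject₁ i) ~ vertex (suc i)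

  end : Vertex
  end = vertex (fromℕ n)

-- In both constructors the path has d = 3 + m vertices: a cycle in a simple
-- graph needs d ≥ 3, and 2 ≤ j ≤ d - 2 forces d ≥ 4.  The closing edge e_d
-- joins v_d to v₁ or to v_j, where j = suc (toℕ i).
data CycleOrLollipop (G : Graph) : Set where
  cycle    : ∀ {m} (P : Path G (2 + m)) →
             Graph._~_ G (Path.end P) (Path.vertex P zero) →
             CycleOrLollipop G
  lollipop : ∀ {m} (P : Path G (2 + m)) (i : Fin (3 + m)) →
             2 ≤ suc (toℕ i) → suc (toℕ i) ≤ (3 + m) ∸ 2 →
             Graph._~_ G (Path.end P) (Path.vertex P i) →
             CycleOrLollipop G

module _ {G : Graph} where
  open Graph G

  IsCycle : CycleOrLollipop G → Set
  IsCycle (cycle _ _)          = ⊤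
  IsCycle (lollipop _ _ _ _ _) = ⊥

  -- In a lollipop the cycle is v_j … v_d, which has d - (j - 1) vertices.
  cycleLength : CycleOrLollipop G → ℕ
  cycleLength (cycle {m} _ _)          = 3 + m
  cycleLength (lollipop {m} _ i _ _ _) = (3 + m) ∸ toℕ i

  firstVertex : CycleOrLollipop G → Vertex
  firstVertex (cycle P _)          = Path.vertex P zero
  firstVertex (lollipop P _ _ _ _) = Path.vertex P zero

  secondVertex : CycleOrLollipop G → Vertex
  secondVertex (cycle P _)          = Path.vertex P (suc zero)
  secondVertex (lollipop P _ _ _ _) = Path.vertex P (suc zero)

  -- The vertex v_d: the sequence itself ends with a repetition of v₁ or v_j.
  secondToLastVertex : CycleOrLollipop G → Vertex
  secondToLastVertex (cycle P _)          = Path.end P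
  secondToLastVertex (lollipop P _ _ _ _) = Path.end P

{-# OPTIONS --safe #-}

-- A 2-list coloring problem is an instance of 2-SAT.  Giving v the color a
-- forces every neighbor whose list contains a to take its other color, and so
-- on.  If this propagation from (v , a) meets no conflict, the forced literals
-- form a consistent set closed under propagation, and such sets can be glued
-- together.  Hence in an uncolorable instance there is a vertex v both of whose
-- colors a and b lead to a conflict.  Such a conflict is a path from v with an
-- edge from its end back to an earlier vertex of the same color, i.e. a cycle or
-- a lollipop, and separation makes its cycle have length at least 4.  In H₁ the
-- neighbors of v along the path or cycle have a in their lists, in H₂ they have b;
-- by separation these are different vertices.  The remaining case is that H₁ is a
-- cycle and H₂ a lollipop with the same second to last vertex: then H₁ is
-- traversed in the opposite direction.
--
-- The argument from conflicts is classical; it becomes constructive because both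
-- the existence of a coloring and that of H₁ and H₂ are decided by finite search.

module Submission where

open import Defs
open import Data.Empty using (⊥)
open import Data.Fin using (Fin; zero; suc; toℕ; fromℕ; inject₁; opposite; finToFun; funToFin; _≟_)
open import Data.Fin.Induction using (<-weakInduction)
open import Data.Fin.Properties using (any?; all?; finToFun-funToFin; injective⇒≤; 0≢1+n;
  inject₁-injective; opposite-involutive; toℕ-inject₁; toℕ≤pred[n]; suc-injective)
open import Data.Fin.Relation.Unary.Top using (View; view; ‵fromℕ; ‵inject₁; view-fromℕ; view-inject₁)
open import Data.Fin.Subset using (Subset; Nonempty; _∈_; _∩_; ∣_∣; inside; outside)
open import Data.Fin.Subset.Properties using (_∈?_; x∈p∩q⁺; x∈p∧x≢y⇒x∈p-y; x∈p⇒∣p-x∣<∣p∣)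
open import Data.List using (List; _∷_; []; allFin)
open import Data.List.Membership.Propositional.Properties using (∈-allFin)
open import Data.List.Relation.Unary.All as All using (All; []; _∷_)
open import Data.List.Relation.Unary.AllPairs using ([]; _∷_)
open import Data.List.Relation.Unary.Unique.Propositional using (Unique)
open import Data.List.Relation.Unary.Unique.DecPropositional using (unique?)
open import Data.Nat using (ℕ; zero; suc; _+_; _∸_; _≤_; _<_; z≤n; s≤s; _≤?_)
open import Data.Nat.Properties using (≤-trans; ≤-reflexive; ≤-<-trans;
  n≤1+n; m≤n+m; anyUpTo?; m+n≤o⇒m≤o∸n)
open import Data.Product using (Σ; Σ-syntax; ∃; _×_; _,_; proj₁; proj₂)
open import Data.Sum using (_⊎_; inj₁; inj₂)
open import Data.Unit using (tt)
open import Data.Vec using (_∷_; here; there)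
open import Function using (_∘_)
open import Function.Definitions using (Injective)
open import Relation.Binary.PropositionalEquality using (_≡_; _≢_; _≗_; refl; sym; trans; cong; subst; subst₂; ≢-sym)
open import Relation.Nullary using (¬_; Dec; yes; no; contradiction)
open import Relation.Nullary.Decidable using (map′; decidable-stable; _×-dec_; _⊎-dec_; _→-dec_; ¬?)

private variable
  m n : ℕ

-- Small subsets

member⇒nonzero : ∀ {p : Subset n} {x} → x ∈ p → 1 ≤ ∣ p ∣
member⇒nonzero x∈p = ≤-<-trans z≤n (x∈p⇒∣p-x∣<∣p∣ x∈p)

distinct-members₂ : ∀ {p : Subset n} {x y} → x ∈ p → y ∈ p → x ≢ y → 2 ≤ ∣ p ∣
distinct-members₂ x∈p y∈p x≢y =
  ≤-trans (s≤s (member⇒nonzero (x∈p∧x≢y⇒x∈p-y x∈p x≢y))) (x∈p⇒∣p-x∣<∣p∣ y∈p)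

distinct-members₃ : ∀ {p : Subset n} {x y z} → x ∈ p → y ∈ p → z ∈ p →
                    x ≢ y → x ≢ z → y ≢ z → 3 ≤ ∣ p ∣
distinct-members₃ x∈p y∈p z∈p x≢y x≢z y≢z =
  ≤-trans (s≤s (distinct-members₂ (x∈p∧x≢y⇒x∈p-y x∈p x≢z) (x∈p∧x≢y⇒x∈p-y y∈p y≢z) x≢y))
          (x∈p⇒∣p-x∣<∣p∣ z∈p)

nonzero⇒nonempty : (p : Subset n) → 1 ≤ ∣ p ∣ → Nonempty p
nonzero⇒nonempty (inside  ∷ p) _ = zero , here
nonzero⇒nonempty (outside ∷ p) h with nonzero⇒nonempty p h
... | x , x∈p = suc x , there x∈p

two-members : (p : Subset n) → 2 ≤ ∣ p ∣ → ∃ λ x → ∃ λ y → x ∈ p × y ∈ p × x ≢ y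
two-members (inside ∷ p) (s≤s h) with nonzero⇒nonempty p h
... | y , y∈p = zero , suc y , here , there y∈p , 0≢1+n
two-members (outside ∷ p) h with two-members p h
... | x , y , x∈p , y∈p , x≢y = suc x , suc y , there x∈p , there y∈p , x≢y ∘ suc-injective

-- Sequences extended at the end

module _ {A : Set} where

  snoc : (Fin n → A) → A → Fin (suc n) → A
  snoc f x i with view i
  ... | ‵fromℕ     = x
  ... | ‵inject₁ j = f j

  snoc-fromℕ : (f : Fin n → A) (x : A) → snoc f x (fromℕ n) ≡ x
  snoc-fromℕ {n} f x rewrite view-fromℕ n = refl

  snoc-inject₁ : (f : Fin n → A) (x : A) → ∀ i → snoc f x (inject₁ i) ≡ f i
  snoc-inject₁ f x i rewrite view-inject₁ i = refl

  snoc-step : (R : A → A → Set) (f : Fin (suc n) → A) (x : A) →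
              (∀ i → R (f (inject₁ i)) (f (suc i))) → R (f (fromℕ n)) x →
              ∀ i → R (snoc f x (inject₁ i)) (snoc f x (suc i))
  snoc-step R f x step last i = go (view i)
    where
    go : ∀ {i} → View i → R (snoc f x (inject₁ i)) (snoc f x (suc i))
    go ‵fromℕ       = subst₂ R (sym (snoc-inject₁ f x _)) (sym (snoc-fromℕ f x)) last
    go (‵inject₁ j) = subst₂ R (sym (snoc-inject₁ f x _)) (sym (snoc-inject₁ f x (suc j))) (step j)

  -- Used with `g = proj₁`: in a sequence of literals it is the vertices that have to differ.
  snoc-distinct : {B : Set} (g : A → B) (f : Fin n → A) (x : A) →
                  Injective _≡_ _≡_ (g ∘ f) → (∀ i → g (f i) ≢ g x) →
                  Injective _≡_ _≡_ (g ∘ snoc f x)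
  snoc-distinct g f x inj fresh {i} {j} eq with view i | view j
  ... | ‵fromℕ     | ‵fromℕ     = refl
  ... | ‵fromℕ     | ‵inject₁ j = contradiction (sym eq) (fresh j)
  ... | ‵inject₁ i | ‵fromℕ     = contradiction eq (fresh i)
  ... | ‵inject₁ i | ‵inject₁ j = cong inject₁ (inj eq)

-- Exhaustive search

-- Proofs of `A`, such as adjacencies, may differ from one another; since `B` transfers between
-- them, testing a single one settles the search.
Σ-dec : {A : Set} {B : A → Set} → Dec A → (∀ a → Dec (B a)) → (∀ {a a′} → B a → B a′) → Dec (Σ A B)
Σ-dec (no ¬a) B? irr = no (¬a ∘ proj₁)
Σ-dec (yes a) B? irr = map′ (a ,_) (irr ∘ proj₂) (B? a)

-- A function is searched for through its code in a finite set. Decoding returns it only up to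
-- pointwise equality, which `Q` therefore has to respect.
anyFun? : {Q : (Fin m → Fin n) → Set} → (∀ f → Dec (Q f)) → (∀ {f g} → f ≗ g → Q f → Q g) → Dec (∃ Q)
anyFun? Q? resp = map′ (λ (_ , q) → _ , q) (λ (f , q) → funToFin f , resp (sym ∘ finToFun-funToFin f) q)
                       (any? (Q? ∘ finToFun))

isCycle? : ∀ {G} (H : CycleOrLollipop G) → Dec (IsCycle H)
isCycle? (cycle _ _)          = yes tt
isCycle? (lollipop _ _ _ _ _) = no λ ()

Good : ∀ {G} → CycleOrLollipop G → CycleOrLollipop G → Set
Good H₁ H₂ =
  (4 ≤ cycleLength H₁ × 4 ≤ cycleLength H₂)
  × firstVertex H₁ ≡ firstVertex H₂
  × secondVertex H₁ ≢ secondVertex H₂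
  × (IsCycle H₁ ⊎ IsCycle H₂ → secondToLastVertex H₁ ≢ secondToLastVertex H₂)
  × (IsCycle H₁ × IsCycle H₂ →
       Unique (secondVertex H₁ ∷ secondToLastVertex H₁
               ∷ secondVertex H₂ ∷ secondToLastVertex H₂ ∷ []))

GoodPair : Graph → Set
GoodPair G = Σ[ H₁ ∈ CycleOrLollipop G ] Σ[ H₂ ∈ CycleOrLollipop G ] Good H₁ H₂

good? : ∀ {G} (H₁ H₂ : CycleOrLollipop G) → Dec (Good H₁ H₂)
good? H₁ H₂ =
  ((4 ≤? _) ×-dec (4 ≤? _))
  ×-dec (_ ≟ _)
  ×-dec ¬? (_ ≟ _)
  ×-dec ((isCycle? H₁ ⊎-dec isCycle? H₂) →-dec ¬? (_ ≟ _))
  ×-dec ((isCycle? H₁ ×-dec isCycle? H₂) →-dec unique? _≟_ _)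

-- Search over paths, cycles and lollipops

module _ {G : Graph} where
  open Graph G
  open Path

  IsPath : (Fin (suc n) → Vertex) → Set
  IsPath f = (∀ i j → f i ≡ f j → i ≡ j) × (∀ i → f (inject₁ i) ~ f (suc i))

  toPath : (f : Fin (suc n) → Vertex) → IsPath f → Path G n
  toPath f (inj , adj) = record { vertex = f ; distinct = inj _ _ ; edge = adj }

  isPath? : (f : Fin (suc n) → Vertex) → Dec (IsPath f)
  isPath? f = (all? λ i → all? λ j → (f i ≟ f j) →-dec (i ≟ j))
              ×-dec all? λ i → f (inject₁ i) ~? f (suc i)

  isPath-resp : {f g : Fin (suc n) → Vertex} → f ≗ g → IsPath f → IsPath g
  isPath-resp f≗g (inj , adj) =
    (λ i j eq → inj i j (trans (f≗g i) (trans eq (sym (f≗g j))))) ,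
    (λ i → subst₂ _~_ (f≗g _) (f≗g _) (adj i))

  anyPath? : {P : Path G n → Set} → (∀ p → Dec (P p)) →
             (∀ {p q} → vertex p ≗ vertex q → P p → P q) → Dec (∃ P)
  anyPath? P? resp =
    map′ (λ (f , ip , h) → toPath f ip , h)
         (λ (p , h) → vertex p , ((λ _ _ → distinct p) , edge p) , resp (λ _ → refl) h)
         (anyFun? (λ f → Σ-dec (isPath? f) (P? ∘ toPath f) (resp λ _ → refl))
                  (λ f≗g (ip , h) → isPath-resp f≗g ip , resp f≗g h))

  -- The data on which `Good` depends. One direction for `IsCycle` is enough to transport `Good`
  -- from `H` to `H′`, because there being a cycle occurs only as a premise.
  record SameShape (H H′ : CycleOrLollipop G) : Set where
    constructor sameShape
    field
      isCycle-reflects : IsCycle H′ → IsCycle H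
      cycleLength-≡    : cycleLength H ≡ cycleLength H′
      first-≡          : firstVertex H ≡ firstVertex H′
      second-≡         : secondVertex H ≡ secondVertex H′
      last-≡           : secondToLastVertex H ≡ secondToLastVertex H′

  sameShape-refl : ∀ {H} → SameShape H H
  sameShape-refl = sameShape (λ c → c) refl refl refl refl

  anyFigure? : {P : CycleOrLollipop G → Set} → (∀ H → Dec (P H)) →
               (∀ {H H′} → SameShape H H′ → P H → P H′) → Dec (∃ P)
  anyFigure? {P} P? resp = map′ from to (anyUpTo? figureOn? order)
    where
    CycleOn LollipopOn : Path G (2 + m) → Set
    CycleOn p    = Σ[ e ∈ end p ~ vertex p zero ] P (cycle p e)
    LollipopOn {m} p = ∃ λ i → Σ[ h ∈ (2 ≤ suc (toℕ i) × suc (toℕ i) ≤ (3 + m) ∸ 2 × end p ~ vertex p i) ]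
      P (lollipop p i (proj₁ h) (proj₁ (proj₂ h)) (proj₂ (proj₂ h)))

    FigureOn : ℕ → Set
    FigureOn m = ∃ (CycleOn {m}) ⊎ ∃ (LollipopOn {m})

    figureOn? : ∀ m → Dec (FigureOn m)
    figureOn? m =
      anyPath? (λ p → Σ-dec (_ ~? _) (P? ∘ cycle p) (resp (sameShape _ refl refl refl refl)))
               (λ eq (e , h) → subst₂ _~_ (eq _) (eq _) e ,
                               resp (sameShape _ refl (eq _) (eq _) (eq _)) h)
      ⊎-dec
      anyPath? (λ p → any? λ i → Σ-dec ((2 ≤? _) ×-dec (_ ≤? _) ×-dec (_ ~? _))
                                       (λ (l , u , e) → P? (lollipop p i l u e))
                                       (resp (sameShape (λ ()) refl refl refl refl)))
               (λ eq (i , (l , u , e) , h) → i , (l , u , subst₂ _~_ (eq _) (eq _) e) ,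
                                             resp (sameShape (λ ()) refl (eq _) (eq _) (eq _)) h)

    from : (∃ λ m → m < order × FigureOn m) → ∃ P
    from (_ , _ , inj₁ (_ , _ , h))     = _ , h
    from (_ , _ , inj₂ (_ , _ , _ , h)) = _ , h

    -- The `3 + m` vertices are distinct, so the order of `G` bounds the search.
    m<order : Path G (2 + m) → m < order
    m<order {m} p = ≤-trans (m≤n+m (suc m) 2) (injective⇒≤ (distinct p))

    to : ∃ P → ∃ λ m → m < order × FigureOn m
    to (cycle p e , h)          = _ , m<order p , inj₁ (p , e , h)
    to (lollipop p i l u e , h) = _ , m<order p , inj₂ (p , i , (l , u , e) , h)

  good-resp : ∀ {H₁ H₁′ H₂ H₂′} → SameShape H₁ H₁′ → SameShape H₂ H₂′ → Good H₁ H₂ → Good H₁′ H₂′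
  good-resp (sameShape c₁ l₁ f₁ s₁ t₁) (sameShape c₂ l₂ f₂ s₂ t₂) (lengths , first , second , last , four)
    rewrite l₁ | f₁ | s₁ | t₁ | l₂ | f₂ | s₂ | t₂ =
    lengths , first , second ,
    (λ { (inj₁ c) → last (inj₁ (c₁ c)) ; (inj₂ c) → last (inj₂ (c₂ c)) }) ,
    (λ (c , d) → four (c₁ c , c₂ d))

  goodPair? : Dec (GoodPair G)
  goodPair? = anyFigure? (λ H₁ → anyFigure? (good? H₁) (good-resp sameShape-refl))
                         (λ s (H₂ , h) → H₂ , good-resp s sameShape-refl h)

  -- Traversing a cycle in the opposite direction

  opposite-inject₁ : (i : Fin n) → opposite (inject₁ i) ≡ suc (opposite i)
  opposite-inject₁ zero    = refl
  opposite-inject₁ (suc i) = cong inject₁ (opposite-inject₁ i)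

  opposite-injective : Injective _≡_ _≡_ (opposite {n})
  opposite-injective eq =
    trans (sym (opposite-involutive _)) (trans (cong opposite eq) (opposite-involutive _))

  -- Negation modulo `suc n`: the first vertex stays and the others are reversed, so that the second
  -- and the last vertex change places.
  turn : Fin (suc n) → Fin (suc n)
  turn zero    = zero
  turn (suc i) = suc (opposite i)

  turn-end : turn (fromℕ (suc n)) ≡ suc zero
  turn-end = cong suc (opposite-involutive zero)

  reverse : (p : Path G (suc n)) → end p ~ vertex p zero → Path G (suc n)
  reverse {n} p e = record { vertex = vertex p ∘ turn ; distinct = turn-injective _ _ ∘ distinct p ; edge = adj }
    where
    turn-injective : ∀ i j → turn i ≡ turn j → i ≡ j
    turn-injective zero    zero    eq = refl
    turn-injective (suc i) (suc j) eq = cong suc (opposite-injective (suc-injective eq))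

    adj : ∀ i → vertex p (turn (inject₁ i)) ~ vertex p (turn (suc i))
    adj zero    = ~-sym e
    adj (suc i) rewrite opposite-inject₁ i = ~-sym (edge p (suc (opposite i)))

  reverse-end : (p : Path G (suc n)) (e : end p ~ vertex p zero) → end (reverse p e) ≡ vertex p (suc zero)
  reverse-end p e = cong (vertex p) turn-end

  reverse-closing : (p : Path G (suc n)) (e : end p ~ vertex p zero) → end (reverse p e) ~ vertex p zero
  reverse-closing p e = subst (_~ vertex p zero) (sym (reverse-end p e)) (~-sym (edge p zero))

  second≢last : ∀ (H : CycleOrLollipop G) → secondVertex H ≢ secondToLastVertex H
  second≢last (cycle p _)          eq with () ← distinct p eq
  second≢last (lollipop p _ _ _ _) eq with () ← distinct p eq

-- Lists of two colors under separation

module Lists (G : Graph) {c : ℕ} (L : Graph.Vertex G → Subset c)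
             (two : ∀ v → ∣ L v ∣ ≡ 2)
             (separated : ∀ x y → Graph._~_ G x y → ∣ L x ∩ L y ∣ ≤ 1) where
  open Graph G
  open Path

  Color : Set
  Color = Fin c

  -- A list of two colors has no room for a third, so avoiding `z` leaves one choice.
  same-other : ∀ {v x y z} → x ∈ L v → y ∈ L v → z ∈ L v → x ≢ z → y ≢ z → x ≡ y
  same-other {v} {x} {y} x∈ y∈ z∈ x≢z y≢z with x ≟ y
  ... | yes x≡y = x≡y
  ... | no  x≢y = contradiction (subst (3 ≤_) (two v) (distinct-members₃ x∈ y∈ z∈ x≢y x≢z y≢z)) λ { (s≤s (s≤s ())) }

  common-color-unique : ∀ {u v x y} → u ~ v → x ∈ L u → x ∈ L v → y ∈ L u → y ∈ L v → x ≡ y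
  common-color-unique {u} {v} {x} {y} u~v xu xv yu yv with x ≟ y
  ... | yes x≡y = x≡y
  ... | no  x≢y = contradiction
    (≤-trans (distinct-members₂ (x∈p∩q⁺ (xu , xv)) (x∈p∩q⁺ (yu , yv)) x≢y) (separated u v u~v)) λ { (s≤s ()) }

  colors : ∀ v → ∃ λ a → ∃ λ b → a ∈ L v × b ∈ L v × a ≢ b
  colors v = two-members (L v) (≤-reflexive (sym (two v)))

  other : ∀ v t → ∃ λ s → s ∈ L v × t ≢ s
  other v t with colors v
  ... | a , b , a∈ , b∈ , a≢b with t ≟ a
  ...   | no t≢a   = a , a∈ , t≢a
  ...   | yes refl = b , b∈ , a≢b

  -- A literal (v , a) reads "v receives the color a".
  Literal : Set
  Literal = Vertex × Color

  record _⇒_ (p q : Literal) : Set where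
    constructor forces
    field
      adjacent : proj₁ p ~ proj₁ q
      blocked  : proj₂ p ∈ L (proj₁ q)
      allowed  : proj₂ q ∈ L (proj₁ q)
      changed  : proj₂ p ≢ proj₂ q
  open _⇒_

  -- Propagation along trails and conflicts

  record Trail (v : Vertex) (a : Color) (n : ℕ) : Set where
    field
      literal  : Fin (suc n) → Literal
      start    : literal zero ≡ (v , a)
      simple   : Injective _≡_ _≡_ (proj₁ ∘ literal)
      step     : ∀ i → literal (inject₁ i) ⇒ literal (suc i)

    vertexAt : Fin (suc n) → Vertex
    vertexAt = proj₁ ∘ literal

    colorAt : Fin (suc n) → Color
    colorAt = proj₂ ∘ literal

    last : Literal
    last = literal (fromℕ n)

    path : Path G n
    path = record { vertex = vertexAt ; distinct = simple ; edge = adjacent ∘ step }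
  open Trail

  trivial : ∀ v a → Trail v a 0
  trivial v a = record { literal = λ _ → v , a ; start = refl ; simple = λ { {zero} {zero} _ → refl } ; step = λ () }

  init : ∀ {v a} → Trail v a (suc n) → Trail v a n
  init T = record
    { literal = literal T ∘ inject₁ ; start = start T
    ; simple = inject₁-injective ∘ simple T ; step = step T ∘ inject₁ }

  extend : ∀ {v a} (T : Trail v a n) q → last T ⇒ q → (∀ i → vertexAt T i ≢ proj₁ q) → Trail v a (suc n)
  extend T q lastStep fresh = record
    { literal = snoc (literal T) q ; start = trans (snoc-inject₁ (literal T) q zero) (start T)
    ; simple = snoc-distinct proj₁ (literal T) q (simple T) fresh
    ; step = snoc-step _⇒_ (literal T) q (step T) lastStep }

  Forced : Vertex → Color → Literal → Set
  Forced v a p = ∃ λ n → Σ[ T ∈ Trail v a n ] last T ≡ p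

  truncate : ∀ {v a} (T : Trail v a n) i → Forced v a (literal T i)
  truncate T i with view i
  truncate         T _ | ‵fromℕ     = _ , T , refl
  truncate {suc n} T _ | ‵inject₁ i = truncate (init T) i

  Conflict : Vertex → Color → Set
  Conflict v a = ∃ λ n → Σ[ T ∈ Trail v a n ] ∃ λ i →
    proj₁ (last T) ~ vertexAt T i × proj₂ (last T) ≡ colorAt T i

  Sound Closed Consistent : (Literal → Set) → Set
  Sound A      = ∀ {v a} → A (v , a) → a ∈ L v
  Closed A     = ∀ {p q} → A p → p ⇒ q → A q
  Consistent A = ∀ {v a b} → A (v , a) → A (v , b) → a ≡ b

  module _ {v : Vertex} {a : Color} (a∈ : a ∈ L v) where

    trail-sound : (T : Trail v a n) → ∀ i → colorAt T i ∈ L (vertexAt T i)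
    trail-sound T zero    rewrite start T = a∈
    trail-sound T (suc i) = allowed (step T i)

    forced-sound : Sound (Forced v a)
    forced-sound (_ , T , refl) = trail-sound T (fromℕ _)

    -- Propagation is contrapositive: p ⇒ q gives ¬ q ⇒ ¬ p, where ¬ exchanges
    -- the two colors of a list.
    backward : {A : Literal → Set} → Closed A → Sound A → (T : Trail v a n) →
               ∀ i {t} → t ≢ colorAt T i → A (vertexAt T i , t) → ∃ λ s → s ≢ a × A (v , s)
    backward {A = A} closed sound T = <-weakInduction
      (λ i → ∀ {t} → t ≢ colorAt T i → A (vertexAt T i , t) → ∃ λ s → s ≢ a × A (v , s))
      atStart back
      where
      atStart : ∀ {t} → t ≢ colorAt T zero → A (vertexAt T zero , t) → ∃ λ s → s ≢ a × A (v , s)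
      atStart {t} rewrite start T = λ t≢a At → t , t≢a , At

      back : ∀ i → (∀ {t} → t ≢ colorAt T (inject₁ i) → A (vertexAt T (inject₁ i) , t) → ∃ λ s → s ≢ a × A (v , s)) →
             ∀ {t} → t ≢ colorAt T (suc i) → A (vertexAt T (suc i) , t) → ∃ λ s → s ≢ a × A (v , s)
      back i rec t≢ At with step T i | other (vertexAt T (inject₁ i)) (colorAt T (inject₁ i))
      ... | forces adj blk alw chg | b , b∈ , c≢b
        with refl ← same-other (sound At) blk alw t≢ chg =
        rec (≢-sym c≢b) (closed At (forces (~-sym adj) (trail-sound T (inject₁ i)) b∈ c≢b))

    module _ (no-conflict : ¬ Conflict v a) where

      -- A literal at a new vertex extends the trail. At a vertex already visited, the color there
      -- differs from the last color for lack of a conflict; so does the new color, hence the two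
      -- agree and an initial piece of the trail ends in the new literal.
      forced-closed : Closed (Forced v a)
      forced-closed {q = u , d} (n , T , refl) s@(forces adj blk alw chg) with any? (λ i → vertexAt T i ≟ u)
      ... | no fresh = suc n , extend T (u , d) s (λ i eq → fresh (i , eq)) , snoc-fromℕ (literal T) (u , d)
      ... | yes (i , refl) with proj₂ (last T) ≟ colorAt T i
      ...   | yes eq = contradiction (n , T , i , adj , eq) no-conflict
      ...   | no neq with refl ← same-other alw (trail-sound T i) blk (≢-sym chg) (≢-sym neq) = truncate T i

      -- A trail with distinct vertices that ends where it starts has no edges.
      forced-root : ∀ {s} → Forced v a (v , s) → s ≡ a
      forced-root (zero , T , eq) = cong proj₂ (trans (sym eq) (start T))
      forced-root (suc n , T , eq) with () ← simple T (trans (cong proj₁ eq) (sym (cong proj₁ (start T))))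

      -- A second color at the end of a trail would propagate backward to a color other than `a` at
      -- `v`, against `forced-root`.
      forced-consistent : Consistent (Forced v a)
      forced-consistent {u} {t} {t′} F (n , T , refl) with t ≟ proj₂ (last T)
      ... | yes eq = eq
      ... | no neq with backward forced-closed forced-sound T (fromℕ n) neq F
      ...   | s , s≢a , F′ = contradiction (forced-root F′) s≢a

  -- Gluing consistent sets into a coloring

  Covers : (Literal → Set) → Vertex → Set
  Covers A v = ∃ λ a → A (v , a)

  -- Were `A` to disagree with a literal forced from `v`, its color would propagate backward along
  -- the trail, and `A` would cover `v`.
  union-consistent : ∀ {A v a} → Sound A → Closed A → Consistent A → ¬ Covers A v →
                     a ∈ L v → ¬ Conflict v a → Consistent (λ p → A p ⊎ Forced v a p)
  union-consistent {A} {v} {a} sound closed consistent uncovered a∈ ok = λ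
    { (inj₁ x) (inj₁ y) → consistent x y
    ; (inj₁ x) (inj₂ y) → agree x y
    ; (inj₂ x) (inj₁ y) → sym (agree y x)
    ; (inj₂ x) (inj₂ y) → forced-consistent a∈ ok x y }
    where
    agree : ∀ {u t t′} → A (u , t) → Forced v a (u , t′) → t ≡ t′
    agree {t = t} At (n , T , refl) with t ≟ proj₂ (last T)
    ... | yes eq = eq
    ... | no neq with backward a∈ closed sound T (fromℕ n) neq At
    ...   | s , _ , As = contradiction (s , As) uncovered

  -- Vertices are added one at a time, each uncovered one together with all literals forced from an
  -- unconflicted color.
  covering : (∀ v → ¬ ¬ (∃ λ a → a ∈ L v × ¬ Conflict v a)) → (vs : List Vertex) →
             ¬ ¬ (Σ[ A ∈ (Literal → Set) ] Sound A × Closed A × Consistent A × All (Covers A) vs)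
  covering unconflicted []       k = k ((λ _ → ⊥) , (λ ()) , (λ ()) , (λ ()) , [])
  covering unconflicted (v ∷ vs) k = covering unconflicted vs λ (A , sound , closed , consistent , covers) →
    unconflicted v λ (a , a∈ , ok) →
    k ( (λ p → A p ⊎ Forced v a p)
      , (λ { (inj₁ x) → sound x ; (inj₂ x) → forced-sound a∈ x })
      , (λ { (inj₁ x) s → inj₁ (closed x s) ; (inj₂ x) s → inj₂ (forced-closed a∈ ok x s) })
      , union-consistent sound closed consistent
          -- If `v` is covered already, `A` itself serves. Coverage is not assumed decidable, but
          -- the double negation admits the case distinction.
          (λ covered → k (A , sound , closed , consistent , covered ∷ covers)) a∈ ok
      , (a , inj₂ (0 , trivial v a , refl)) ∷ All.map (λ (b , x) → b , inj₁ x) covers )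

  Coloring : (Vertex → Color) → Set
  Coloring φ = (∀ x y → x ~ y → φ x ≢ φ y) × (∀ v → φ v ∈ L v)

  coloring? : Dec (∃ Coloring)
  coloring? = anyFun?
    (λ φ → (all? λ x → all? λ y → (x ~? y) →-dec ¬? (φ x ≟ φ y)) ×-dec all? λ v → φ v ∈? L v)
    (λ f≗g (proper , φ∈) →
      (λ x y x~y eq → proper x y x~y (trans (f≗g x) (trans eq (sym (f≗g y))))) ,
      (λ v → subst (_∈ L v) (f≗g v) (φ∈ v)))

  covering⇒coloring : {A : Literal → Set} → Sound A → Closed A → Consistent A → (∀ v → Covers A v) → ∃ Coloring
  covering⇒coloring {A} sound closed consistent covers = φ , proper , (λ v → sound (covered v))
    where
    φ : Vertex → Color
    φ v = proj₁ (covers v)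

    covered : ∀ v → A (v , φ v)
    covered v = proj₂ (covers v)

    proper : ∀ x y → x ~ y → φ x ≢ φ y
    -- Equal colors at `x` and `y` would force the other color `s` of `y` as well, against
    -- consistency.
    proper x y x~y eq with other y (φ x)
    ... | s , s∈ , φx≢s = φx≢s (trans eq (consistent (covered y)
      (closed (covered x) (forces x~y (subst (_∈ L y) (sym eq) (sound (covered y))) s∈ φx≢s))))

  -- The closing edge cannot go back one step since the colors change, nor two
  -- steps since the last two lists would share two colors.
  conflict-gap : ∀ {v a} → a ∈ L v → (T : Trail v a n) (i : Fin (suc n)) →
                 proj₁ (last T) ~ vertexAt T i → proj₂ (last T) ≡ colorAt T i → 3 + toℕ i ≤ n
  conflict-gap a∈ T i adj eq with view i
  ... | ‵fromℕ = contradiction adj (~-irrefl refl)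
  conflict-gap {suc n} a∈ T _ adj eq | ‵inject₁ j with view j
  ... | ‵fromℕ = contradiction (sym eq) (changed (step T (fromℕ n)))
  conflict-gap {suc (suc n)} a∈ T _ adj eq | _ | ‵inject₁ j with view j
  ... | ‵fromℕ = contradiction
    (common-color-unique (adjacent (step T (suc (fromℕ n))))
      (blocked (step T (inject₁ (fromℕ n))))
      (subst (_∈ L (vertexAt T (suc (suc (fromℕ n))))) eq (allowed (step T (suc (fromℕ n)))))
      (allowed (step T (inject₁ (fromℕ n)))) (blocked (step T (suc (fromℕ n)))))
    (changed (step T (inject₁ (fromℕ n))))
  conflict-gap {suc (suc (suc n))} a∈ T _ adj eq | _ | _ | ‵inject₁ j
    rewrite toℕ-inject₁ (inject₁ (inject₁ j)) | toℕ-inject₁ (inject₁ j) | toℕ-inject₁ j =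
    s≤s (s≤s (s≤s (toℕ≤pred[n] j)))

  -- Cycles and lollipops from conflicts

  record Witness (v : Vertex) (a : Color) (H : CycleOrLollipop G) : Set where
    field
      length≥4     : 4 ≤ cycleLength H
      first        : firstVertex H ≡ v
      v~second     : v ~ secondVertex H
      a∈second     : a ∈ L (secondVertex H)
      cycle⇒v~last : IsCycle H → v ~ secondToLastVertex H
      cycle⇒a∈last : IsCycle H → a ∈ L (secondToLastVertex H)
  open Witness

  conflict⇒witness : ∀ {v a} → a ∈ L v → Conflict v a → ∃ (Witness v a)
  conflict⇒witness a∈ (n , T , i , adj , eq) with conflict-gap a∈ T i adj eq
  conflict⇒witness a∈ (_ , T , zero , adj , eq) | s≤s (s≤s (s≤s _)) = cycle (path T) adj , record
    { length≥4     = s≤s (s≤s (s≤s (s≤s z≤n)))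
    ; first        = cong proj₁ (start T)
    ; v~second     = subst (λ p → proj₁ p ~ _) (start T) (adjacent (step T zero))
    ; a∈second     = subst (λ p → proj₂ p ∈ L (vertexAt T (suc zero))) (start T) (blocked (step T zero))
    ; cycle⇒v~last = λ _ → ~-sym (subst (λ p → _ ~ proj₁ p) (start T) adj)
    -- The trail closes up at its first literal, so its last color is `a` again.
    ; cycle⇒a∈last = λ _ → subst (_∈ L _) (trans eq (cong proj₂ (start T))) (trail-sound a∈ T (fromℕ _))
    }
  conflict⇒witness a∈ (_ , T , suc i , adj , eq) | gap@(s≤s (s≤s (s≤s i<n))) =
    -- In terms of `d` and `j`, the gap says `j ≤ d - 3`. This is one better than a lollipop
    -- requires and rules out a triangle.
    lollipop (path T) (suc i) (s≤s (s≤s z≤n)) (s≤s (≤-trans i<n (n≤1+n _))) adj , record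
    { length≥4     = m+n≤o⇒m≤o∸n 4 (s≤s gap)
    ; first        = cong proj₁ (start T)
    ; v~second     = subst (λ p → proj₁ p ~ _) (start T) (adjacent (step T zero))
    ; a∈second     = subst (λ p → proj₂ p ∈ L (vertexAt T (suc zero))) (start T) (blocked (step T zero))
    ; cycle⇒v~last = λ ()
    ; cycle⇒a∈last = λ ()
    }

  reverse-witness : ∀ {v a} (p : Path G (2 + m)) (e : end p ~ vertex p zero) → Witness v a (cycle p e) →
                    Witness v a (cycle (reverse p e) (reverse-closing p e))
  reverse-witness p e w = record
    { length≥4     = length≥4 w
    ; first        = first w
    ; v~second     = cycle⇒v~last w tt
    ; a∈second     = cycle⇒a∈last w tt
    ; cycle⇒v~last = λ _ → subst (_ ~_) (sym (reverse-end p e)) (v~second w)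
    ; cycle⇒a∈last = λ _ → subst (λ x → _ ∈ L x) (sym (reverse-end p e)) (a∈second w)
    }

  -- Choosing the two subgraphs

  module _ {v : Vertex} {a b : Color} (a∈ : a ∈ L v) (b∈ : b ∈ L v) (a≢b : a ≢ b) where

    -- A common neighbor having both `a` and `b` would share two colors with `v`.
    separate : ∀ {x y} → v ~ x → a ∈ L x → b ∈ L y → x ≢ y
    separate v~x a∈x b∈y refl = a≢b (common-color-unique v~x a∈ a∈x b∈ b∈y)

    second-distinct : ∀ {H₁ H₂} → Witness v a H₁ → Witness v b H₂ → secondVertex H₁ ≢ secondVertex H₂
    second-distinct w₁ w₂ = separate (v~second w₁) (a∈second w₁) (a∈second w₂)

  -- The two directions of a cycle have different last vertices, so at least one of them avoids `w`.
  avoid-last : ∀ {v a} (p : Path G (2 + m)) (e : end p ~ vertex p zero) → Witness v a (cycle p e) →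
    (w : Vertex) → Σ[ q ∈ Path G (2 + m) ] Σ[ e′ ∈ end q ~ vertex q zero ] Witness v a (cycle q e′) × end q ≢ w
  avoid-last p e W w with end p ≟ w
  ... | no neq   = p , e , W , neq
  ... | yes refl = reverse p e , reverse-closing p e , reverse-witness p e W ,
    λ eq → second≢last (cycle p e) (trans (sym (reverse-end p e)) eq)

  -- Two lollipops need only distinct second vertices. A single cycle is turned if the last vertices
  -- coincide. For two cycles, `separate` applies to all neighbors of `v` on them.
  combine : ∀ {v a b} → a ∈ L v → b ∈ L v → a ≢ b → ∃ (Witness v a) → ∃ (Witness v b) →
            GoodPair G
  combine a∈ b∈ a≢b (H₁@(lollipop _ _ _ _ _) , w₁) (H₂@(lollipop _ _ _ _ _) , w₂) = H₁ , H₂ ,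
    (length≥4 w₁ , length≥4 w₂) , trans (first w₁) (sym (first w₂)) , second-distinct a∈ b∈ a≢b w₁ w₂ ,
    (λ { (inj₁ ()) ; (inj₂ ()) }) , λ ()
  combine a∈ b∈ a≢b (cycle p e , w₁) (H₂@(lollipop _ _ _ _ _) , w₂)
    with q , e′ , w₁′ , neq ← avoid-last p e w₁ (secondToLastVertex H₂) = cycle q e′ , H₂ ,
    (length≥4 w₁′ , length≥4 w₂) , trans (first w₁′) (sym (first w₂)) , second-distinct a∈ b∈ a≢b w₁′ w₂ ,
    (λ _ → neq) , λ ()
  combine a∈ b∈ a≢b (H₁@(lollipop _ _ _ _ _) , w₁) (cycle p e , w₂)
    with q , e′ , w₂′ , neq ← avoid-last p e w₂ (secondToLastVertex H₁) = H₁ , cycle q e′ ,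
    (length≥4 w₁ , length≥4 w₂′) , trans (first w₁) (sym (first w₂′)) , second-distinct a∈ b∈ a≢b w₁ w₂′ ,
    (λ _ → ≢-sym neq) , λ ()
  combine a∈ b∈ a≢b (H₁@(cycle _ _) , w₁) (H₂@(cycle _ _) , w₂) = H₁ , H₂ ,
    (length≥4 w₁ , length≥4 w₂) , trans (first w₁) (sym (first w₂)) , s₁≢s₂ , (λ _ → t₁≢t₂) ,
    λ _ → (second≢last H₁ ∷ s₁≢s₂ ∷ s₁≢t₂ ∷ []) ∷ (t₁≢s₂ ∷ t₁≢t₂ ∷ []) ∷ (second≢last H₂ ∷ []) ∷ [] ∷ []
    where
    s₁≢s₂ = second-distinct a∈ b∈ a≢b w₁ w₂
    s₁≢t₂ = separate a∈ b∈ a≢b (v~second w₁) (a∈second w₁) (cycle⇒a∈last w₂ tt)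
    t₁≢s₂ = separate a∈ b∈ a≢b (cycle⇒v~last w₁ tt) (cycle⇒a∈last w₁ tt) (a∈second w₂)
    t₁≢t₂ = separate a∈ b∈ a≢b (cycle⇒v~last w₁ tt) (cycle⇒a∈last w₁ tt) (cycle⇒a∈last w₂ tt)

  no-goodPair⇒coloring : ¬ GoodPair G → ∃ Coloring
  no-goodPair⇒coloring none = decidable-stable coloring? λ uncolorable →
    covering unconflicted (allFin order) λ (A , sound , closed , consistent , covers) →
      uncolorable (covering⇒coloring sound closed consistent (λ v → All.lookup covers (∈-allFin v)))
    where
    unconflicted : ∀ v → ¬ ¬ (∃ λ a → a ∈ L v × ¬ Conflict v a)
    unconflicted v k with colors v
    ... | a , b , a∈ , b∈ , a≢b =
      -- Refuting that either color is free of conflicts yields conflicts for both, without deciding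
      -- `Conflict`.
      k (a , a∈ , λ Ca → k (b , b∈ , λ Cb →
        none (combine a∈ b∈ a≢b (conflict⇒witness a∈ Ca) (conflict⇒witness b∈ Cb))))

theorem2p4 : ∀ (G : Graph) →
    ¬ SeparationChoosable G 2 →
    Σ[ H₁ ∈ CycleOrLollipop G ] Σ[ H₂ ∈ CycleOrLollipop G ]
    (4 ≤ cycleLength H₁ × 4 ≤ cycleLength H₂)
    × firstVertex H₁ ≡ firstVertex H₂
    × secondVertex H₁ ≢ secondVertex H₂
    × (IsCycle H₁ ⊎ IsCycle H₂ → secondToLastVertex H₁ ≢ secondToLastVertex H₂)
    × (IsCycle H₁ × IsCycle H₂ →
    Unique (secondVertex H₁ ∷ secondToLastVertex H₁
    ∷ secondVertex H₂ ∷ secondToLastVertex H₂ ∷ []))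
-- Choosability ranges over all palettes, so the search is for the good pair: assuming there is
-- none, every assignment has a coloring.
theorem2p4 G ¬choosable = decidable-stable goodPair? λ none →
  ¬choosable λ c L two separated → Lists.no-goodPair⇒coloring G L two separated none
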